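{- For all integers $k\ge0$ and $s=0,1,\dots,k$, $$C_{s+1,\underbrace{0,\dots,0}_{s}}^{s+1,s+1,k+1}=\sigma(k+1,k-s).$$
   Context: $\sigma(k,s)$ are the Stirling numbers of the second kind (number of partitions of a $k$-element set into $s$ nonempty blocks). For integers $k\ge1$, $1\le s\le k-1$, $1\le m\le s$ and nonnegative integers $\alpha_1,\dots,\alpha_s$ with $\sum_{i=1}^s\alpha_i=m$, $\sum_{i=1}^s i\alpha_i=s$, the numbers $C_{\alpha_1,\dots,\alpha_s}^{s,m,k}$ are the uniquely determined universal numbers (not depending on $u$) such that for every entire or meromorphic function $u$ on $\mathbb{C}$ the operator $A=u(z)\frac{d}{dz}$ satisfies $$A^{k}=u^k\Big(\frac{d}{dz}\Big)^k+\sum_{s=1}^{k-1}\Big(\sum_{m=1}^{s}u^{k-m}\sum_{m,s}C_{\alpha_1,\dots,\alpha_s}^{s,m,k}\Big(\frac{du}{dz}\Big)^{\alpha_1}\cdots\Big(\frac{d^su}{dz^s}\Big)^{\alpha_s}\Big)\Big(\frac{d}{dz}\Big)^{k-s},$$ where $\sum_{m,s}$ is over all nonnegative integers $\alpha_1,\dots,\alpha_s$ with $\sum_{i=1}^s\alpha_i=m$ and $\sum_{i=1}^s i\alpha_i=s$. In addition, $C_{\alpha_1,\dots,\alpha_k}^{k,m,k}=0$ by convention (the coefficient of $(d/dz)^0$ in $A^k$ is $0$). -}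

module Defs where

open import Level using (Level; _⊔_) renaming (suc to lsuc)
open import Algebra.Bundles using (CommutativeRing; Semiring)
open import Algebra.Apartness.Bundles using (HeytingField; HeytingCommutativeRing)
open import Algebra.Morphism.Structures using (module RingMorphisms)
import Algebra.Definitions.RawSemiring as RawSemiringDefinitions
open import Data.Nat.Base as ℕ using (ℕ; zero; suc; _∸_; _≤_; s≤s)
import Data.Nat.Properties as ℕ
open import Data.Fin.Base using (Fin; toℕ)
open import Data.Fin.Subset using (Subset; Nonempty; Empty; _∩_; _∈_; inside; outside)
open import Data.Fin.Subset.Properties using (nonempty?; _∈?_)
import Data.Fin.Properties as Fin
open import Data.List.Base as List
  using (List; []; _∷_; _++_; map; foldr; filter; length; upTo; cartesianProductWith)
open import Data.List.Relation.Unary.All as All using (All)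
open import Data.List.Relation.Unary.Any as Any using (Any; here)
open import Data.List.Relation.Unary.AllPairs as AllPairs using (AllPairs; allPairs?)
open import Data.List.Relation.Unary.Unique.Propositional using (Unique)
import Data.List.Relation.Unary.Unique.Propositional.Properties as Unique
import Data.List.Membership.Propositional as List
import Data.List.Membership.Propositional.Properties as List
open import Data.Product.Base using (_×_; _,_)
open import Data.Vec.Base as Vec using (Vec; []; _∷_; lookup; tabulate; zipWith)
import Data.Vec.Relation.Unary.All as VecAll
open import Function.Base using (_∘_)
open import Function.Bundles using (_⇔_; mk⇔)
open import Relation.Binary.PropositionalEquality using (_≡_; refl)
open import Relation.Nullary using (¬_; Dec)
open import Relation.Nullary.Decidable using (_×-dec_; ¬?)

private
  variable
    a : Level
    A : Set a

tuples : List A → (n : ℕ) → List (Vec A n)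
tuples xs zero    = [] ∷ []
tuples xs (suc n) = cartesianProductWith _∷_ xs (tuples xs n)

-- The sublists of length s.  If xs has no repetitions, every s-element
-- subset of its elements is listed exactly once.
choose : ℕ → List A → List (List A)
choose zero    xs       = [] ∷ []
choose (suc s) []       = []
choose (suc s) (x ∷ xs) = map (x ∷_) (choose s xs) ++ choose (suc s) xs

------------------------------------------------------------------------
-- Stirling numbers of the second kind

Disjoint : ∀ {k} → Subset k → Subset k → Set
Disjoint p q = Empty (p ∩ q)

IsPartition : ∀ {k} → List (Subset k) → Set
IsPartition bs = All Nonempty bs × AllPairs Disjoint bs × (∀ x → Any (x ∈_) bs)

isPartition? : ∀ {k} (bs : List (Subset k)) → Dec (IsPartition bs)
isPartition? bs =
  All.all? nonempty? bs
    ×-dec allPairs? (λ p q → ¬? (nonempty? (p ∩ q))) bs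
    ×-dec Fin.all? (λ x → Any.any? (x ∈?_) bs)

subsets : (k : ℕ) → List (Subset k)
subsets = tuples (outside ∷ inside ∷ [])

stirling : ℕ → ℕ → ℕ
stirling k s = length (filter isPartition? (choose s (subsets k)))

------------------------------------------------------------------------
-- Exponent vectors (α₁ , … , αₛ) with Σ αᵢ = m and Σ i αᵢ = s

weight : ∀ {n} → Vec ℕ n → ℕ
weight α = Vec.sum (zipWith ℕ._*_ (tabulate (suc ∘ toℕ)) α)

IsExponent : (s m : ℕ) → Vec ℕ s → Set
IsExponent s m α = Vec.sum α ≡ m × weight α ≡ s

isExponent? : (s m : ℕ) (α : Vec ℕ s) → Dec (IsExponent s m α)
isExponent? s m α = (Vec.sum α ℕ.≟ m) ×-dec (weight α ℕ.≟ s)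

-- Σ αᵢ = m forces αᵢ ≤ m, so searching {0, …, m}ˢ loses nothing; see
-- ∈-exponents and unique-exponents.
exponents : (s m : ℕ) → List (Vec ℕ s)
exponents s m = filter (isExponent? s m) (tuples (upTo (suc m)) s)

∈-tuples : ∀ {xs : List A} {n} {v : Vec A n} →
           VecAll.All (List._∈ xs) v → v List.∈ tuples xs n
∈-tuples VecAll.[]         = here refl
∈-tuples (px VecAll.∷ pxs) = List.∈-cartesianProductWith⁺ _∷_ px (∈-tuples pxs)

entries≤ : ∀ {n m} (α : Vec ℕ n) → Vec.sum α ≤ m → VecAll.All (List._∈ upTo (suc m)) α
entries≤ []      _ = VecAll.[]
entries≤ (x ∷ α) p =
  List.∈-upTo⁺ (s≤s (ℕ.m+n≤o⇒m≤o x p)) VecAll.∷ entries≤ α (ℕ.m+n≤o⇒n≤o x p)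

∈-exponents : ∀ {s m} {α : Vec ℕ s} → α List.∈ exponents s m ⇔ IsExponent s m α
∈-exponents {s} {m} {α} = mk⇔
  (λ α∈ → let _ , p = List.∈-filter⁻ (isExponent? s m) {xs = tuples (upTo (suc m)) s} α∈ in p)
  (λ { p@(refl , _) → List.∈-filter⁺ (isExponent? s m) (∈-tuples (entries≤ α ℕ.≤-refl)) p })

unique-tuples : ∀ {xs : List A} → Unique xs → ∀ n → Unique (tuples xs n)
unique-tuples xs! zero    = All.[] AllPairs.∷ AllPairs.[]
unique-tuples xs! (suc n) =
  Unique.cartesianProductWith⁺ _∷_ (λ { refl → refl , refl }) xs! (unique-tuples xs! n)

unique-exponents : ∀ s m → Unique (exponents s m)
unique-exponents s m =
  Unique.filter⁺ (isExponent? s m) (unique-tuples (Unique.upTo⁺ (suc m)) s)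

------------------------------------------------------------------------
-- Numbers and functions

-- The field of numbers, e.g. ℂ.
record CharZeroField (c ℓ₁ ℓ₂ : Level) : Set (lsuc (c ⊔ ℓ₁ ⊔ ℓ₂)) where
  field
    heytingField : HeytingField c ℓ₁ ℓ₂
  open HeytingField heytingField public
  commutativeRing : CommutativeRing c ℓ₁
  commutativeRing = HeytingCommutativeRing.commutativeRing heytingCommutativeRing
  open CommutativeRing commutativeRing public using (rawRing; semiring)
  open Semiring semiring public using (rawSemiring)
  field
    charZero : let open RawSemiringDefinitions rawSemiring renaming (_×_ to _·_) in
               ∀ n → (suc n · 1#) # 0#

-- A ring of functions of one variable z over the field K: a nontrivial
-- commutative K-algebra with a K-linear derivation ∂ = d/dz and a coordinate
-- function z.  For K = ℂ, both the entire functions and the meromorphic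
-- functions on ℂ are instances.
record FunctionRing {c ℓ₁ ℓ₂ : Level} (K : CharZeroField c ℓ₁ ℓ₂) (r ℓ : Level)
                    : Set (c ⊔ ℓ₁ ⊔ lsuc (r ⊔ ℓ)) where
  private module K = CharZeroField K
  field
    commutativeRing : CommutativeRing r ℓ
  open CommutativeRing commutativeRing public
  open Semiring semiring public using (rawSemiring)
  open RingMorphisms K.rawRing rawRing using (IsRingHomomorphism)
  field
    nontrivial  : ¬ (1# ≈ 0#)
    const       : K.Carrier → Carrier
    const-homo  : IsRingHomomorphism const
    ∂           : Carrier → Carrier
    ∂-cong      : ∀ {f g} → f ≈ g → ∂ f ≈ ∂ g
    ∂-+         : ∀ f g → ∂ (f + g) ≈ ∂ f + ∂ g
    ∂-*         : ∀ f g → ∂ (f * g) ≈ ∂ f * g + f * ∂ g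
    ∂-const     : ∀ x → ∂ (const x) ≈ 0#
    z           : Carrier
    ∂-z         : ∂ z ≈ 1#

------------------------------------------------------------------------
-- The expansion of Aᵏ for A = u(z) d/dz

module _ {c ℓ₁ ℓ₂ : Level} (K : CharZeroField c ℓ₁ ℓ₂) where
  private module K = CharZeroField K

  -- C s m k α is the number written with upper indices s, m, k and lower
  -- indices α.  It carries meaning only if IsExponent s m α.
  Coefficients : Set c
  Coefficients = (s m k : ℕ) → Vec ℕ s → K.Carrier

  module _ {r ℓ : Level} (M : FunctionRing K r ℓ) where
    open FunctionRing M
    open RawSemiringDefinitions rawSemiring using (_^_; sum; product)

    iter : (Carrier → Carrier) → ℕ → Carrier → Carrier
    iter T zero    f = f
    iter T (suc n) f = T (iter T n f)

    sumFrom1To : ℕ → (ℕ → Carrier) → Carrier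
    sumFrom1To n f = sum {n} (λ i → f (suc (toℕ i)))

    sumOver : ∀ {a} {A : Set a} → List A → (A → Carrier) → Carrier
    sumOver xs f = foldr (λ x y → f x + y) 0# xs

    A[_] : Carrier → Carrier → Carrier
    A[ u ] f = u * ∂ f

    -- (du/dz)^α₁ ⋯ (dˢu/dzˢ)^αₛ
    monomial : ∀ {s} → Carrier → Vec ℕ s → Carrier
    monomial {s} u α = product {s} (λ i → iter ∂ (suc (toℕ i)) u ^ lookup α i)

    expansion : Coefficients → ℕ → Carrier → Carrier → Carrier
    expansion C k u f =
      u ^ k * iter ∂ k f
      + sumFrom1To (k ∸ 1) (λ s →
          sumFrom1To s (λ m →
            u ^ (k ∸ m) * sumOver (exponents s m) (λ α → const (C s m k α) * monomial u α))
          * iter ∂ (k ∸ s) f)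

    -- The conditions that determine the numbers C: one family works for all
    -- u, operators being compared by their action on functions f; and C with
    -- s = k is 0 by convention.
    record IsExpansionCoefficients (C : Coefficients) : Set (ℓ₁ ⊔ r ⊔ ℓ) where
      field
        expands    : ∀ k → 1 ≤ k → ∀ u f → iter A[ u ] k f ≈ expansion C k u f
        convention : ∀ k m α → 1 ≤ k → 1 ≤ m → m ≤ k → IsExponent k m α →
                     C k m k α K.≈ K.0#

fromℕ : ∀ {c ℓ₁ ℓ₂ : Level} (K : CharZeroField c ℓ₁ ℓ₂) → ℕ → CharZeroField.Carrier K
fromℕ K n = n · 1#
  where
  open CharZeroField K
  open RawSemiringDefinitions rawSemiring renaming (_×_ to _·_)

{-# OPTIONS --safe #-}
-- Take u = z.  All derivatives of u from the second on vanish and u′ = 1, so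
-- the only monomials that survive in the expansion of (z d/dz)ᵏ are the powers
-- (u′)ˢ, with m = s.  Hence the numbers in question are the coefficients of
-- (z d/dz)ᵏ with respect to the operators zʲ(d/dz)ʲ, and these are the Stirling
-- numbers, by the recurrence S(k+1, j+1) = S(k, j) + (j+1) S(k, j+1).  The
-- coefficients are unique: evaluate successively at f = zⁿ, n = 0, 1, ….
module Submission where

open import Defs
open import Level using (Level)
open import Algebra.Bundles using (CommutativeRing)
import Algebra.Definitions.RawSemiring as RawSemiringDefinitions
open import Algebra.Morphism.Structures using (module RingMorphisms)
import Algebra.Properties.CommutativeMonoid.Mult as CommutativeMonoidMult
import Algebra.Properties.CommutativeMonoid.Sum as CommutativeMonoidSum
import Algebra.Properties.CommutativeSemigroup as CommutativeSemigroupProperties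
import Algebra.Properties.Group as GroupProperties
import Algebra.Properties.Semiring.Mult as SemiringMult
open import Data.Fin.Base as Fin using (Fin; zero; suc; toℕ; fromℕ<; punchIn)
open import Data.Fin.Permutation using (reverse)
open import Data.Fin.Properties
  using (toℕ-inject₁; toℕ-fromℕ; toℕ-fromℕ<; toℕ<n; toℕ-injective; punchInᵢ≢i; opposite-prop)
open import Data.List.Base using (List; []; _∷_)
open import Data.List.Relation.Unary.All as All using (All; []; _∷_)
open import Data.List.Relation.Unary.AllPairs as AllPairs using (AllPairs; []; _∷_)
open import Data.List.Relation.Unary.Any as Any using (Any; here; there)
open import Data.List.Relation.Unary.Unique.Propositional using (Unique)
open import Data.Nat.Base as ℕ using (ℕ; zero; suc; _∸_; _≤_; _<_; s≤s; z≤n; NonZero; _!)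
open import Data.Nat.Induction using (<-rec)
import Data.Nat.Properties as ℕ
open import Data.Product.Base using (_×_; _,_; proj₁; ∃; ∃₂)
open import Data.Sum.Base using (_⊎_; inj₁; inj₂)
open import Data.Vec.Base as Vec using (Vec; []; _∷_; lookup; replicate; zipWith; tabulate; here; there)
open import Data.Vec.Functional using (Vector)
open import Data.Vec.Properties using (lookup-replicate)
open import Function.Base using (_∘_)
open import Function.Bundles using (Equivalence)
open import Relation.Binary.Definitions using (tri<; tri≈; tri>)
open import Relation.Binary.PropositionalEquality as ≡ using (_≡_; _≢_)
open import Relation.Nullary using (¬_; Dec; yes; no; contradiction)

-- Stirling numbers

-- Since `stirling` counts sublists of an explicit list of subsets, the recurrence is obtained
-- without constructing bijections. The indicator of a partition is treated as a weight on lists,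
-- and totals of a weight over all sublists are computed by induction on the underlying list; this
-- works for weights that ignore the order of a list. In the uniqueness argument the obstacle is
-- that a `FunctionRing` may have zero divisors, so powers of z cannot be cancelled. Differentiating
-- until a constant remains replaces the division, and characteristic zero makes the factorials that
-- appear invertible.

module StirlingRecurrence where

  open import Data.Nat.Base using (_+_; _*_)
  open import Data.Nat.ListAction using (sum)
  open import Data.Nat.ListAction.Properties using (sum-++)
  open import Data.Nat.Properties
    using (+-assoc; +-identityʳ; *-comm; *-identityʳ; *-zeroʳ; *-distribˡ-+; m<n⇒m<1+n;
           +-commutativeSemigroup)
  open import Data.Nat.Tactic.RingSolver using (solve-∀)
  open import Data.Fin.Subset using (Subset; Nonempty; Empty; _∈_; inside; outside)
  open import Data.Fin.Subset.Properties
    using (nonempty?; drop-there; drop-∷-Empty; x∈p∩q⁺; x∈p∩q⁻; ∩-comm)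
  open import Data.List.Base using (_++_; map; filter; length)
  open import Data.List.Properties using (map-++; map-∘; map-cong; ++-identityʳ)
  open import Data.List.Relation.Binary.Permutation.Propositional
    using (_↭_; ↭-refl; ↭-sym; ↭-trans; prep; swap; ↭⇒↭ₛ)
  open import Data.List.Relation.Binary.Permutation.Propositional.Properties
    using (All-resp-↭; Any-resp-↭)
  import Data.List.Relation.Binary.Permutation.Setoid.Properties as Permutationₛ
  import Data.List.Relation.Unary.All.Properties as All
  import Data.List.Relation.Unary.AllPairs.Properties as AllPairs
  import Data.List.Relation.Unary.Any.Properties as Any
  open import Relation.Binary.PropositionalEquality
    using (refl; sym; trans; cong; cong₂; subst; setoid; resp₂; module ≡-Reasoning)
  open import Relation.Nullary.Decidable using (¬?)
  open import Relation.Unary using (Pred; Decidable)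
  open CommutativeSemigroupProperties +-commutativeSemigroup using (interchange)

  open ≡-Reasoning

  private
    variable
      A B : Set

  -- Weights summed over sublists

  total : (A → ℕ) → List A → ℕ
  total w xs = sum (map w xs)

  total-cong : ∀ {v w : A → ℕ} → (∀ x → v x ≡ w x) → ∀ xs → total v xs ≡ total w xs
  total-cong v≗w xs = cong sum (map-cong v≗w xs)

  total-0 : ∀ {w : A → ℕ} → (∀ x → w x ≡ 0) → ∀ xs → total w xs ≡ 0
  total-0 w≡0 []       = refl
  total-0 w≡0 (x ∷ xs) = cong₂ _+_ (w≡0 x) (total-0 w≡0 xs)

  total-map : ∀ (w : B → ℕ) (f : A → B) xs → total w (map f xs) ≡ total (w ∘ f) xs
  total-map w f xs = cong sum (sym (map-∘ xs))

  total-++ : ∀ (w : A → ℕ) xs ys → total w (xs ++ ys) ≡ total w xs + total w ys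
  total-++ w xs ys = trans (cong sum (map-++ w xs ys)) (sum-++ (map w xs) (map w ys))

  total-+ : ∀ (v w : A → ℕ) xs → total (λ x → v x + w x) xs ≡ total v xs + total w xs
  total-+ v w []       = refl
  total-+ v w (x ∷ xs) = trans (cong (v x + w x +_) (total-+ v w xs)) (interchange (v x) (w x) _ _)

  total-* : ∀ c (w : A → ℕ) xs → total (λ x → c * w x) xs ≡ c * total w xs
  total-* c w []       = sym (*-zeroʳ c)
  total-* c w (x ∷ xs) = trans (cong (c * w x +_) (total-* c w xs)) (sym (*-distribˡ-+ c (w x) _))

  total-choose-∷ : ∀ (w : List A → ℕ) s x xs →
                   total w (choose (suc s) (x ∷ xs))
                   ≡ total (w ∘ (x ∷_)) (choose s xs) + total w (choose (suc s) xs)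
  total-choose-∷ w s x xs =
    trans (total-++ w (map (x ∷_) (choose s xs)) _) (cong (_+ _) (total-map w (x ∷_) (choose s xs)))

  -- `choose` produces each sublist in one order only. Weights of this kind do not see the order, so
  -- a particular entry may be moved to the front.
  Symmetric : (List A → ℕ) → Set
  Symmetric {A} w = ∀ {xs ys : List A} → xs ↭ ys → w xs ≡ w ys

  -- Each (s + 1)-element sublist arises s + 1 times as an s-element sublist with
  -- a distinguished further element.
  total-choose-point : ∀ {w : List A → ℕ} → Symmetric w → (∀ x zs → w (x ∷ x ∷ zs) ≡ 0) → ∀ s xs →
                       total (λ p → total (w ∘ (p ∷_)) (choose s xs)) xs
                       ≡ suc s * total w (choose (suc s) xs)
  total-choose-point w-sym w-dup s []       = sym (*-zeroʳ s)
  total-choose-point {w = w} w-sym w-dup zero (x ∷ xs) = begin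
    w (x ∷ []) + 0 + total (λ p → w (p ∷ []) + 0) xs
      ≡⟨ cong (w (x ∷ []) + 0 +_) (total-choose-point w-sym w-dup zero xs) ⟩
    w (x ∷ []) + 0 + 1 * total w (choose 1 xs)
      ≡⟨ rearrange (w (x ∷ [])) _ ⟩
    1 * (w (x ∷ []) + total w (choose 1 xs)) ∎
    where
    rearrange : ∀ a b → a + 0 + 1 * b ≡ 1 * (a + b)
    rearrange = solve-∀
  total-choose-point {w = w} w-sym w-dup (suc s) (x ∷ xs) = begin
    total (w ∘ (x ∷_)) (choose (suc s) (x ∷ xs))
    + total (λ p → total (w ∘ (p ∷_)) (choose (suc s) (x ∷ xs))) xs
      ≡⟨ cong₂ _+_ (total-choose-∷ _ s x xs)
                   (trans (total-cong (λ p → total-choose-∷ _ s x xs) xs) (total-+ _ _ xs)) ⟩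
    total (w ∘ (x ∷_) ∘ (x ∷_)) (choose s xs) + a
    + (total (λ p → total (w ∘ (p ∷_) ∘ (x ∷_)) (choose s xs)) xs
       + total (λ p → total (w ∘ (p ∷_)) (choose (suc s) xs)) xs)
      ≡⟨ cong₂ _+_ (cong (_+ a) (total-0 (w-dup x) (choose s xs)))
                   (cong₂ _+_
                     (total-cong (λ p → total-cong (λ zs → w-sym (swap p x (↭-refl {x = zs}))) (choose s xs)) xs)
                     (total-choose-point w-sym w-dup (suc s) xs)) ⟩
    a + (total (λ p → total (w ∘ (x ∷_) ∘ (p ∷_)) (choose s xs)) xs + suc (suc s) * b)
      ≡⟨ cong (λ n → a + (n + suc (suc s) * b)) (total-choose-point (w-sym ∘ prep x) w-dup′ s xs) ⟩
    a + (suc s * a + suc (suc s) * b)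
      ≡⟨ rearrange s a b ⟩
    suc (suc s) * (a + b)
      ≡⟨ cong (suc (suc s) *_) (total-choose-∷ w (suc s) x xs) ⟨
    suc (suc s) * total w (choose (suc (suc s)) (x ∷ xs)) ∎
    where
    a = total (w ∘ (x ∷_)) (choose (suc s) xs)
    b = total w (choose (suc (suc s)) xs)
    w-dup′ : ∀ p zs → w (x ∷ p ∷ p ∷ zs) ≡ 0
    w-dup′ p zs = trans (w-sym (↭-trans (swap x p ↭-refl) (prep p (swap x p ↭-refl)))) (w-dup p (x ∷ zs))
    rearrange : ∀ s a b → a + (suc s * a + suc (suc s) * b) ≡ suc (suc s) * (a + b)
    rearrange = solve-∀

  module _ {f g : A → B} where

    -- By symmetry the weight vanishes on every sublist with at least two entries from `map g ys`.
    -- The sublists that count have no such entry, or exactly one, and symmetry lets that one stand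
    -- first.
    total-choose-map-++ :
      ∀ {w : List B → ℕ} → Symmetric w → (∀ p q zs → w (g p ∷ g q ∷ zs) ≡ 0) → ∀ s xs ys →
      total w (choose (suc s) (map f xs ++ map g ys))
      ≡ total (w ∘ map f) (choose (suc s) xs) + total (λ p → total (w ∘ (g p ∷_) ∘ map f) (choose s xs)) ys
    total-choose-map-++ w-sym w-g s [] [] = refl
    total-choose-map-++ {w} w-sym w-g zero [] (y ∷ ys) = begin
      w (g y ∷ []) + total w (choose 1 (map g ys))
        ≡⟨ cong₂ _+_ (sym (+-identityʳ _)) (total-choose-map-++ w-sym w-g zero [] ys) ⟩
      w (g y ∷ []) + 0 + total (λ p → w (g p ∷ []) + 0) ys ∎
    total-choose-map-++ {w} w-sym w-g (suc s) [] (y ∷ ys) = begin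
      total w (choose (suc (suc s)) (g y ∷ map g ys))
        ≡⟨ total-choose-∷ w (suc s) (g y) (map g ys) ⟩
      total (w ∘ (g y ∷_)) (choose (suc s) (map g ys)) + total w (choose (suc (suc s)) (map g ys))
        ≡⟨ cong₂ _+_ (total-choose-map-++ (w-sym ∘ prep (g y)) w-g′ s [] ys)
                     (total-choose-map-++ w-sym w-g (suc s) [] ys) ⟩
      total (λ p → total (w ∘ (g y ∷_) ∘ (g p ∷_) ∘ map f) (choose s [])) ys + total (λ p → 0) ys
        -- `choose s []` holds just the empty list if `s` is 0 and nothing otherwise. The two
        -- entries from `g` make the weight 0 in either case.
        ≡⟨ cong (_+ total (λ p → 0) ys)
                (total-0 (λ p → total-0 (λ zs → w-g y p _) (choose s [])) ys) ⟩
      total (λ p → 0) ys ∎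
      where
      w-g′ : ∀ p q zs → w (g y ∷ g p ∷ g q ∷ zs) ≡ 0
      w-g′ p q zs = w-g y p _
    total-choose-map-++ {w} w-sym w-g zero (x ∷ xs) ys = begin
      w (f x ∷ []) + total w (choose 1 (map f xs ++ map g ys))
        ≡⟨ cong (w (f x ∷ []) +_) (total-choose-map-++ w-sym w-g zero xs ys) ⟩
      w (f x ∷ []) + (total (w ∘ map f) (choose 1 xs) + total (λ p → w (g p ∷ []) + 0) ys)
        ≡⟨ +-assoc (w (f x ∷ [])) _ _ ⟨
      w (f x ∷ []) + total (w ∘ map f) (choose 1 xs) + total (λ p → w (g p ∷ []) + 0) ys ∎
    total-choose-map-++ {w} w-sym w-g (suc s) (x ∷ xs) ys = begin
      total w (choose (suc (suc s)) (f x ∷ map f xs ++ map g ys))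
        ≡⟨ total-choose-∷ w (suc s) (f x) (map f xs ++ map g ys) ⟩
      total (w ∘ (f x ∷_)) (choose (suc s) (map f xs ++ map g ys))
      + total w (choose (suc (suc s)) (map f xs ++ map g ys))
        ≡⟨ cong₂ _+_ (total-choose-map-++ (w-sym ∘ prep (f x)) w-g′ s xs ys)
                     (total-choose-map-++ w-sym w-g (suc s) xs ys) ⟩
      a + total (λ p → total (w ∘ (f x ∷_) ∘ (g p ∷_) ∘ map f) (choose s xs)) ys + (c + d)
        ≡⟨ cong (λ n → a + n + (c + d))
                (total-cong (λ p → total-cong (λ zs → w-sym (swap (f x) (g p) ↭-refl)) (choose s xs)) ys) ⟩
      a + b + (c + d)
        ≡⟨ interchange a b c d ⟩
      a + c + (b + d)
        ≡⟨ cong₂ _+_ (total-choose-∷ (w ∘ map f) (suc s) x xs)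
                     (trans (total-cong (λ p → total-choose-∷ _ s x xs) ys) (total-+ _ _ ys)) ⟨
      total (w ∘ map f) (choose (suc (suc s)) (x ∷ xs))
      + total (λ p → total (w ∘ (g p ∷_) ∘ map f) (choose (suc s) (x ∷ xs))) ys ∎
      where
      a = total (w ∘ map f ∘ (x ∷_)) (choose (suc s) xs)
      b = total (λ p → total (w ∘ (g p ∷_) ∘ map f ∘ (x ∷_)) (choose s xs)) ys
      c = total (w ∘ map f) (choose (suc (suc s)) xs)
      d = total (λ p → total (w ∘ (g p ∷_) ∘ map f) (choose (suc s) xs)) ys
      w-g′ : ∀ p q zs → w (f x ∷ g p ∷ g q ∷ zs) ≡ 0
      w-g′ p q zs =
        trans (w-sym (↭-trans (swap (f x) (g p) ↭-refl) (prep (g p) (swap (f x) (g q) ↭-refl)))) (w-g p q _)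

  -- The indicator of a partition

  𝟙[_] : ∀ {P : Set} → Dec P → ℕ
  𝟙[ yes _ ] = 1
  𝟙[ no _ ]  = 0

  𝟙-false : ∀ {P : Set} (P? : Dec P) → ¬ P → 𝟙[ P? ] ≡ 0
  𝟙-false (yes p) ¬p = contradiction p ¬p
  𝟙-false (no _)  ¬p = refl

  𝟙-cong : ∀ {P Q : Set} (P? : Dec P) (Q? : Dec Q) → (P → Q) → (Q → P) → 𝟙[ P? ] ≡ 𝟙[ Q? ]
  𝟙-cong (yes p) (yes q) to from = refl
  𝟙-cong (yes p) (no ¬q) to from = contradiction (to p) ¬q
  𝟙-cong (no ¬p) Q?      to from = sym (𝟙-false Q? (¬p ∘ from))

  length-filter : ∀ {P : Pred A _} (P? : Decidable P) xs → length (filter P? xs) ≡ total (λ x → 𝟙[ P? x ]) xs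
  length-filter P? [] = refl
  length-filter P? (x ∷ xs) with P? x
  ... | yes _ = cong suc (length-filter P? xs)
  ... | no _  = length-filter P? xs

  isPart : ∀ {k} → List (Subset k) → ℕ
  isPart bs = 𝟙[ isPartition? bs ]

  Disjoint-sym : ∀ {k} {p q : Subset k} → Disjoint p q → Disjoint q p
  Disjoint-sym {p = p} {q} = subst Empty (∩-comm p q)

  IsPartition-resp-↭ : ∀ {k} {bs cs : List (Subset k)} → bs ↭ cs → IsPartition bs → IsPartition cs
  IsPartition-resp-↭ σ (ne , disj , cover) =
    All-resp-↭ σ ne ,
    Permutationₛ.AllPairs-resp-↭ (setoid _) (λ {p} {q} → Disjoint-sym {p = p} {q}) (resp₂ Disjoint)
                                 (↭⇒↭ₛ σ) disj ,
    λ x → Any-resp-↭ σ (cover x)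

  isPart-sym : ∀ {k} → Symmetric (isPart {k})
  isPart-sym σ =
    𝟙-cong (isPartition? _) (isPartition? _) (IsPartition-resp-↭ σ) (IsPartition-resp-↭ (↭-sym σ))

  -- `total-choose-point` prepends an arbitrary element, possibly one already chosen. Such lists
  -- weigh nothing because a nonempty block meets itself.
  isPart-dup : ∀ {k} (p : Subset k) bs → isPart (p ∷ p ∷ bs) ≡ 0
  isPart-dup p bs = 𝟙-false (isPartition? _)
    λ { ((x , x∈p) ∷ _ , (disj ∷ _) ∷ _ , _) → disj (x , x∈p∩q⁺ (x∈p , x∈p)) }

  isPart-inside² : ∀ {k} (p q : Subset k) bs → isPart ((inside ∷ p) ∷ (inside ∷ q) ∷ bs) ≡ 0
  isPart-inside² p q bs = 𝟙-false (isPartition? _) λ { (_ , (disj ∷ _) ∷ _ , _) → disj (zero , here) }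

  isPart-outside : ∀ {k} (bs : List (Subset k)) → isPart (map (outside ∷_) bs) ≡ 0
  isPart-outside bs = 𝟙-false (isPartition? _) λ { (_ , _ , cover) → absurd bs (cover zero) }
    where
    absurd : ∀ bs → ¬ Any (zero ∈_) (map (outside ∷_) bs)
    absurd (b ∷ bs) (there z∈) = absurd bs z∈

  ∷-Empty : ∀ {k} {p : Subset k} → Empty p → Empty (outside ∷ p)
  ∷-Empty e (suc x , there x∈p) = e (x , x∈p)

  ∷-Nonempty : ∀ {k s} {p : Subset k} → Nonempty p → Nonempty (s ∷ p)
  ∷-Nonempty (x , x∈p) = suc x , there x∈p

  drop-∷-Nonempty : ∀ {k} {p : Subset k} → Nonempty (outside ∷ p) → Nonempty p
  drop-∷-Nonempty (suc x , there x∈p) = x , x∈p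

  module _ {k : ℕ} {p : Subset k} where

    -- Deleting 0 from its block preserves disjointness and covering, but may leave `p` empty. Hence
    -- nonemptiness is asked of `bs` alone, while the other two conditions concern `p ∷ bs`.
    partition⁺ : ∀ {bs} → All Nonempty bs → AllPairs Disjoint (p ∷ bs) → (∀ x → Any (x ∈_) (p ∷ bs)) →
                 IsPartition ((inside ∷ p) ∷ map (outside ∷_) bs)
    partition⁺ {bs} ne (p-disj ∷ disj) cover =
      (zero , here) ∷ All.map⁺ (All.map ∷-Nonempty ne) ,
      All.map⁺ (All.map ∷-Empty p-disj) ∷ AllPairs.map⁺ (AllPairs.map ∷-Empty disj) ,
      cover′
      where
      extend : ∀ {x} → Any (x ∈_) (p ∷ bs) → Any (suc x ∈_) ((inside ∷ p) ∷ map (outside ∷_) bs)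
      extend (here x∈p) = here (there x∈p)
      extend (there x∈) = there (Any.map⁺ (Any.map there x∈))
      cover′ : ∀ x → Any (x ∈_) ((inside ∷ p) ∷ map (outside ∷_) bs)
      cover′ zero    = here here
      cover′ (suc x) = extend (cover x)

    partition⁻ : ∀ {bs} → IsPartition ((inside ∷ p) ∷ map (outside ∷_) bs) →
                 All Nonempty bs × AllPairs Disjoint (p ∷ bs) × (∀ x → Any (x ∈_) (p ∷ bs))
    partition⁻ {bs} (_ ∷ ne , p-disj ∷ disj , cover) =
      All.map drop-∷-Nonempty (All.map⁻ ne) ,
      All.map drop-∷-Empty (All.map⁻ p-disj) ∷ AllPairs.map drop-∷-Empty (AllPairs.map⁻ disj) ,
      λ x → restrict (cover (suc x))
      where
      restrict : ∀ {x} → Any (suc x ∈_) ((inside ∷ p) ∷ map (outside ∷_) bs) → Any (x ∈_) (p ∷ bs)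
      restrict (here (there x∈p)) = here x∈p
      restrict (there x∈)         = there (Any.map drop-there (Any.map⁻ x∈))

    -- Removing the element 0 from its block p ∪ {0} either leaves a block or
    -- makes the block disappear.
    isPart-inside : ∀ bs → isPart ((inside ∷ p) ∷ map (outside ∷_) bs)
                           ≡ isPart bs * 𝟙[ ¬? (nonempty? p) ] + isPart (p ∷ bs)
    isPart-inside bs = byCases (nonempty? p)
      where
      uncover : ¬ Nonempty p → ∀ {x} → Any (x ∈_) (p ∷ bs) → Any (x ∈_) bs
      uncover ¬ne-p (here x∈p) = contradiction (_ , x∈p) ¬ne-p
      uncover ¬ne-p (there x∈) = x∈
      -- The decision is an argument so that `𝟙[ ¬? ne? ]` computes to 0 or 1 in each case.
      byCases : (ne? : Dec (Nonempty p)) →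
                isPart ((inside ∷ p) ∷ map (outside ∷_) bs) ≡ isPart bs * 𝟙[ ¬? ne? ] + isPart (p ∷ bs)
      byCases (yes ne-p) = begin
        isPart ((inside ∷ p) ∷ map (outside ∷_) bs)
          ≡⟨ 𝟙-cong (isPartition? _) (isPartition? _)
               (λ h → let ne , disj , cover = partition⁻ h in ne-p ∷ ne , disj , cover)
               (λ { (_ ∷ ne , disj , cover) → partition⁺ ne disj cover }) ⟩
        isPart (p ∷ bs)
          ≡⟨ cong (_+ isPart (p ∷ bs)) (*-zeroʳ (isPart bs)) ⟨
        isPart bs * 0 + isPart (p ∷ bs) ∎
      byCases (no ¬ne-p) = begin
        isPart ((inside ∷ p) ∷ map (outside ∷_) bs)
          ≡⟨ 𝟙-cong (isPartition? _) (isPartition? _)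
               (λ h → let ne , disj , cover = partition⁻ h in
                   ne , AllPairs.tail disj , λ x → uncover ¬ne-p (cover x))
               (λ (ne , disj , cover) →
                 -- The empty `p` is disjoint from every block, and `bs` alone covers all points.
                 partition⁺ ne (All.universal (λ b (x , x∈) → ¬ne-p (x , proj₁ (x∈p∩q⁻ p b x∈))) bs ∷ disj)
                            (λ x → there (cover x))) ⟩
        isPart bs
          ≡⟨ trans (+-identityʳ _) (*-identityʳ (isPart bs)) ⟨
        isPart bs * 1 + 0
          ≡⟨ cong (isPart bs * 1 +_) (𝟙-false (isPartition? (p ∷ bs)) λ { (ne-p ∷ _ , _) → ¬ne-p ne-p }) ⟨
        isPart bs * 1 + isPart (p ∷ bs) ∎

  -- The recurrence for Stirling numbers

  subsets-suc : ∀ k → subsets (suc k) ≡ map (outside ∷_) (subsets k) ++ map (inside ∷_) (subsets k)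
  subsets-suc k = cong (map (outside ∷_) (subsets k) ++_) (++-identityʳ _)

  total-empty : ∀ k → total (λ p → 𝟙[ ¬? (nonempty? p) ]) (subsets k) ≡ 1
  total-empty zero    = refl
  total-empty (suc k) = begin
    total e (subsets (suc k))
      ≡⟨ cong (total e) (subsets-suc k) ⟩
    total e (map (outside ∷_) (subsets k) ++ map (inside ∷_) (subsets k))
      ≡⟨ total-++ e (map (outside ∷_) (subsets k)) _ ⟩
    total e (map (outside ∷_) (subsets k)) + total e (map (inside ∷_) (subsets k))
      ≡⟨ cong₂ _+_ (trans (total-map e _ (subsets k)) (total-cong outside-empty (subsets k)))
                   (trans (total-map e _ (subsets k)) (total-0 inside-nonempty (subsets k))) ⟩
    total (λ p → 𝟙[ ¬? (nonempty? p) ]) (subsets k) + 0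
      ≡⟨ +-identityʳ _ ⟩
    total (λ p → 𝟙[ ¬? (nonempty? p) ]) (subsets k)
      ≡⟨ total-empty k ⟩
    1 ∎
    where
    e : ∀ {k} → Subset k → ℕ
    e p = 𝟙[ ¬? (nonempty? p) ]
    outside-empty : ∀ p → e (outside ∷ p) ≡ e p
    outside-empty p = 𝟙-cong (¬? (nonempty? _)) (¬? (nonempty? _)) drop-∷-Empty ∷-Empty
    inside-nonempty : ∀ p → e (inside ∷ p) ≡ 0
    inside-nonempty p = 𝟙-false (¬? (nonempty? (inside ∷ p))) (λ ¬ne → ¬ne (zero , here))

  stirling-total : ∀ k s → stirling k s ≡ total isPart (choose s (subsets k))
  stirling-total k s = length-filter isPartition? (choose s (subsets k))

  -- Classify the partitions by the block `inside ∷ p` of the element 0. If `p` is empty, the other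
  -- `s` blocks partition the remaining points. Otherwise `p` is a distinguished block in a
  -- partition of these points into `suc s` blocks, which leaves `suc s` choices by
  -- `total-choose-point`.
  stirling-suc-suc : ∀ k s → stirling (suc k) (suc s) ≡ stirling k s + suc s * stirling k (suc s)
  stirling-suc-suc k s = begin
    stirling (suc k) (suc s)
      ≡⟨ stirling-total (suc k) (suc s) ⟩
    total isPart (choose (suc s) (subsets (suc k)))
      ≡⟨ cong (total isPart ∘ choose (suc s)) (subsets-suc k) ⟩
    total isPart (choose (suc s) (map (outside ∷_) X ++ map (inside ∷_) X))
      -- At most one block contains 0, by disjointness; the next step discards the families with no
      -- such block, since they do not cover 0.
      ≡⟨ total-choose-map-++ isPart-sym isPart-inside² s X X ⟩
    total (isPart ∘ map (outside ∷_)) (choose (suc s) X)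
    + total (λ p → total (isPart ∘ ((inside ∷ p) ∷_) ∘ map (outside ∷_)) (choose s X)) X
      ≡⟨ cong (_+ total (λ p → total (isPart ∘ ((inside ∷ p) ∷_) ∘ map (outside ∷_)) (choose s X)) X)
              (total-0 isPart-outside (choose (suc s) X)) ⟩
    total (λ p → total (isPart ∘ ((inside ∷ p) ∷_) ∘ map (outside ∷_)) (choose s X)) X
      ≡⟨ total-cong (λ p → trans (total-cong isPart-inside (choose s X)) (split p)) X ⟩
    total (λ p → total isPart (choose s X) * 𝟙[ ¬? (nonempty? p) ] + total (isPart ∘ (p ∷_)) (choose s X)) X
      ≡⟨ trans (total-+ _ _ X) (cong₂ _+_ (total-* (total isPart (choose s X)) _ X)
                                            (total-choose-point isPart-sym isPart-dup s X)) ⟩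
    total isPart (choose s X) * total (λ p → 𝟙[ ¬? (nonempty? p) ]) X + suc s * total isPart (choose (suc s) X)
      ≡⟨ cong (_+ suc s * total isPart (choose (suc s) X))
              (trans (cong (total isPart (choose s X) *_) (total-empty k))
                     (*-identityʳ (total isPart (choose s X)))) ⟩
    total isPart (choose s X) + suc s * total isPart (choose (suc s) X)
      ≡⟨ cong₂ (λ a b → a + suc s * b) (stirling-total k s) (stirling-total k (suc s)) ⟨
    stirling k s + suc s * stirling k (suc s) ∎
    where
    X = subsets k
    split : ∀ p → total (λ bs → isPart bs * 𝟙[ ¬? (nonempty? p) ] + isPart (p ∷ bs)) (choose s X)
                  ≡ total isPart (choose s X) * 𝟙[ ¬? (nonempty? p) ] + total (isPart ∘ (p ∷_)) (choose s X)
    split p = trans (total-+ _ _ (choose s X)) (cong (_+ total (isPart ∘ (p ∷_)) (choose s X)) (begin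
      total (λ bs → isPart bs * e) (choose s X) ≡⟨ total-cong (λ bs → *-comm (isPart bs) e) (choose s X) ⟩
      total (λ bs → e * isPart bs) (choose s X) ≡⟨ total-* e isPart (choose s X) ⟩
      e * total isPart (choose s X)             ≡⟨ *-comm e _ ⟩
      total isPart (choose s X) * e ∎))
      where e = 𝟙[ ¬? (nonempty? p) ]

  stirling-> : ∀ k {s} → k < s → stirling k s ≡ 0
  -- The only subset of the empty set is empty and so cannot be a block, and there is no second
  -- subset to choose.
  stirling-> zero    {suc zero}    _ = refl
  stirling-> zero    {suc (suc s)} _ = refl
  stirling-> (suc k) {suc s} (s≤s k<s) = begin
    stirling (suc k) (suc s)
      ≡⟨ stirling-suc-suc k s ⟩
    stirling k s + suc s * stirling k (suc s)
      ≡⟨ cong₂ (λ a b → a + suc s * b) (stirling-> k k<s) (stirling-> k (m<n⇒m<1+n k<s)) ⟩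
    suc s * 0
      ≡⟨ *-zeroʳ s ⟩
    0 ∎

-- Exponent vectors

zero-or-positive : ∀ {n} (α : Vec ℕ n) → α ≡ replicate n 0 ⊎ ∃₂ λ i a → lookup α i ≡ suc a
zero-or-positive []          = inj₁ ≡.refl
zero-or-positive (suc a ∷ α) = inj₂ (zero , a , ≡.refl)
zero-or-positive (zero ∷ α) with zero-or-positive α
... | inj₁ ≡.refl      = inj₁ ≡.refl
... | inj₂ (i , a , p) = inj₂ (suc i , a , p)

sum-replicate-0 : ∀ n → Vec.sum (replicate n 0) ≡ 0
sum-replicate-0 zero    = ≡.refl
sum-replicate-0 (suc n) = sum-replicate-0 n

sum-zipWith-*-replicate-0 : ∀ {n} (v : Vec ℕ n) → Vec.sum (zipWith ℕ._*_ v (replicate n 0)) ≡ 0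
sum-zipWith-*-replicate-0 []      = ≡.refl
sum-zipWith-*-replicate-0 (x ∷ v) =
  ≡.cong₂ ℕ._+_ (ℕ.*-zeroʳ x) (sum-zipWith-*-replicate-0 v)

sum-first : ∀ a n → Vec.sum (a ∷ replicate n 0) ≡ a
sum-first a n = ≡.trans (≡.cong (a ℕ.+_) (sum-replicate-0 n)) (ℕ.+-identityʳ a)

-- Together with `sum-first` this forces `m ≡ s` for an exponent vector concentrated in its first
-- entry.
weight-first : ∀ a n → weight (a ∷ replicate n 0) ≡ a
weight-first a n =
  ≡.trans (≡.cong₂ ℕ._+_ (ℕ.*-identityˡ a)
                         (sum-zipWith-*-replicate-0 (tabulate {n = n} (λ i → suc (suc (toℕ i))))))
          (ℕ.+-identityʳ a)

-- The expansion of (z d/dz)ᵏ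

module FieldProperties {c ℓ₁ ℓ₂ : Level} (K : CharZeroField c ℓ₁ ℓ₂) where
  open CharZeroField K
  open CommutativeRing commutativeRing using (+-group)
  open GroupProperties +-group using (ε⁻¹≈ε)
  open import Relation.Binary.Reasoning.Setoid setoid

  fromℕ#0 : ∀ n .{{_ : NonZero n}} → fromℕ K n # 0#
  fromℕ#0 (suc n) = charZero n

  #0⇒invertibleʳ : ∀ {x} → x # 0# → ∃ λ y → x * y ≈ 1#
  -- `#⇒invertible` inverts the difference of two apart elements, here `x - 0#`.
  #0⇒invertibleʳ {x} x#0 = let y , _ , x-0*y≈1 = #⇒invertible x#0 in y , (begin
    x * y          ≈⟨ *-congʳ (trans (+-congˡ ε⁻¹≈ε) (+-identityʳ x)) ⟨
    (x - 0#) * y   ≈⟨ x-0*y≈1 ⟩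
    1#             ∎)

  *-cancelʳ-0 : ∀ {x y} → y # 0# → x * y ≈ 0# → x ≈ 0#
  *-cancelʳ-0 {x} {y} y#0 xy≈0 = let y⁻¹ , yy⁻¹≈1 = #0⇒invertibleʳ y#0 in begin
    x               ≈⟨ *-identityʳ x ⟨
    x * 1#          ≈⟨ *-congˡ yy⁻¹≈1 ⟨
    x * (y * y⁻¹)   ≈⟨ *-assoc x y y⁻¹ ⟨
    (x * y) * y⁻¹   ≈⟨ *-congʳ xy≈0 ⟩
    0# * y⁻¹        ≈⟨ zeroˡ y⁻¹ ⟩
    0#              ∎

module FunctionRingProperties
  {c ℓ₁ ℓ₂ r ℓ : Level} {K : CharZeroField c ℓ₁ ℓ₂} (M : FunctionRing K r ℓ) where

  private module K = CharZeroField K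
  open FunctionRing M
  open RingMorphisms K.rawRing rawRing using (module IsRingHomomorphism)
  open IsRingHomomorphism const-homo using (⟦⟧-cong; +-homo; *-homo; 0#-homo; 1#-homo)
  open RawSemiringDefinitions rawSemiring using (_^_; product)
  open CommutativeMonoidSum +-commutativeMonoid using
    (sum; sum-cong-≋; sum-replicate-zero; sum-init-last; sum-permute; sum-remove; ∑-distrib-+)
  private module Product = CommutativeMonoidSum *-commutativeMonoid
  open SemiringMult semiring using (×-congʳ; ×-homo-+; ×-assocˡ; ×-comm-*; ×-assoc-*)
    renaming (_×_ to _·_)
  open CommutativeMonoidMult +-commutativeMonoid using () renaming (×-distrib-+ to ·-distrib-+)
  open GroupProperties +-group using (identityʳ-unique)
  open import Relation.Binary.Reasoning.Setoid setoid
  open import Data.List.Membership.Propositional using (_∈_)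
  open StirlingRecurrence using (stirling-suc-suc; stirling->)

  -- Finite sums and additive operators

  sum-0 : ∀ {n} {t : Vector Carrier n} → (∀ i → t i ≈ 0#) → sum t ≈ 0#
  sum-0 {n} t≈0 = trans (sum-cong-≋ t≈0) (sum-replicate-zero n)

  sum-last : ∀ n (g : ℕ → Carrier) → sum {suc n} (g ∘ toℕ) ≈ sum {n} (g ∘ toℕ) + g n
  sum-last n g = begin
    sum {suc n} (g ∘ toℕ)
      ≈⟨ sum-init-last (g ∘ toℕ) ⟩
    sum {n} (g ∘ toℕ ∘ Fin.inject₁) + g (toℕ (Fin.fromℕ n))
      ≈⟨ +-cong (sum-cong-≋ {n} (λ i → reflexive (≡.cong g (toℕ-inject₁ i))))
                (reflexive (≡.cong g (toℕ-fromℕ n))) ⟩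
    sum {n} (g ∘ toℕ) + g n ∎

  sum-reverse : ∀ n (g : ℕ → Carrier) → sum {suc n} (λ i → g (n ∸ toℕ i)) ≈ sum {suc n} (g ∘ toℕ)
  sum-reverse n g = begin
    sum {suc n} (λ i → g (n ∸ toℕ i))
      ≈⟨ sum-cong-≋ {suc n} (λ i → reflexive (≡.cong g (opposite-prop i))) ⟨
    sum {suc n} (λ i → g (toℕ (Fin.opposite i)))
      ≈⟨ sum-permute {suc n} (g ∘ toℕ) reverse ⟨
    sum {suc n} (g ∘ toℕ) ∎

  sum-single : ∀ {n} (t : Vector Carrier n) i → (∀ j → j ≢ i → t j ≈ 0#) → sum t ≈ t i
  sum-single {suc n} t i t≈0 = begin
    sum t                                      ≈⟨ sum-remove {i = i} t ⟩
    t i + sum (λ j → t (punchIn i j))          ≈⟨ +-congˡ (sum-0 (λ j → t≈0 _ (punchInᵢ≢i i j))) ⟩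
    t i + 0#                                   ≈⟨ +-identityʳ (t i) ⟩
    t i                                        ∎

  sumOver-0 : ∀ {a} {A : Set a} (xs : List A) {g : A → Carrier} →
              (∀ {x} → x ∈ xs → g x ≈ 0#) → sumOver K M xs g ≈ 0#
  sumOver-0 []       g≈0 = refl
  sumOver-0 (x ∷ xs) g≈0 =
    trans (+-cong (g≈0 (here ≡.refl)) (sumOver-0 xs (g≈0 ∘ there))) (+-identityˡ 0#)

  sumOver-single : ∀ {a} {A : Set a} {xs : List A} {g : A → Carrier} {x} → Unique xs → x ∈ xs →
                   (∀ {y} → y ∈ xs → y ≢ x → g y ≈ 0#) → sumOver K M xs g ≈ g x
  sumOver-single {xs = _ ∷ xs} (x∉xs ∷ _) (here ≡.refl) g≈0 =
    trans (+-congˡ (sumOver-0 xs (λ y∈ → g≈0 (there y∈) (All.lookup x∉xs y∈ ∘ ≡.sym))))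
          (+-identityʳ _)
  sumOver-single (y∉xs ∷ xs!) (there x∈) g≈0 =
    trans (+-cong (g≈0 (here ≡.refl) (All.lookup y∉xs x∈)) (sumOver-single xs! x∈ (g≈0 ∘ there)))
          (+-identityˡ _)

  -- An arbitrary additive operator, because both `∂` and `z∂` are needed as instances.
  module Additive {T : Carrier → Carrier} (T-cong : ∀ {f g} → f ≈ g → T f ≈ T g)
                  (T-+ : ∀ f g → T (f + g) ≈ T f + T g) where

    T-0 : T 0# ≈ 0#
    T-0 = identityʳ-unique (T 0#) (T 0#) (trans (sym (T-+ 0# 0#)) (T-cong (+-identityʳ 0#)))

    T-· : ∀ n f → T (n · f) ≈ n · T f
    T-· zero    f = T-0
    T-· (suc n) f = trans (T-+ f (n · f)) (+-congˡ (T-· n f))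

    T-sum : ∀ {n} (t : Vector Carrier n) → T (sum t) ≈ sum (T ∘ t)
    T-sum {zero}  t = T-0
    T-sum {suc n} t = trans (T-+ _ _) (+-congˡ (T-sum (t ∘ suc)))

    iter-cong : ∀ n {f g} → f ≈ g → iter K M T n f ≈ iter K M T n g
    iter-cong zero    f≈g = f≈g
    iter-cong (suc n) f≈g = T-cong (iter-cong n f≈g)

    iter-0 : ∀ n → iter K M T n 0# ≈ 0#
    iter-0 zero    = refl
    iter-0 (suc n) = trans (T-cong (iter-0 n)) T-0

    iter-· : ∀ n m f → iter K M T n (m · f) ≈ m · iter K M T n f
    iter-· zero    m f = refl
    iter-· (suc n) m f = trans (T-cong (iter-· n m f)) (T-· m _)

  iter-suc : ∀ T n f → iter K M T (suc n) f ≡ iter K M T n (T f)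
  iter-suc T zero    f = ≡.refl
  iter-suc T (suc n) f = ≡.cong T (iter-suc T n f)

  open Additive ∂-cong ∂-+ using ()
    renaming (T-0 to ∂-0; iter-cong to ∂^-cong; iter-0 to ∂^-0; iter-· to ∂^-·)

  ∂^ : ℕ → Carrier → Carrier
  ∂^ = iter K M ∂

  -- Constants and derivatives of powers of z

  const-fromℕ : ∀ n → const (fromℕ K n) ≈ n · 1#
  const-fromℕ zero    = 0#-homo
  const-fromℕ (suc n) = trans (+-homo _ _) (+-cong 1#-homo (const-fromℕ n))

  const-fromℕ-* : ∀ n f → const (fromℕ K n) * f ≈ n · f
  const-fromℕ-* n f = begin
    const (fromℕ K n) * f   ≈⟨ *-congʳ (const-fromℕ n) ⟩
    (n · 1#) * f            ≈⟨ ×-assoc-* n 1# f ⟩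
    n · (1# * f)            ≈⟨ ×-congʳ n (*-identityˡ f) ⟩
    n · f                   ∎

  -- By tightness of the apartness it suffices to refute `x # 0#`. Such an `x` would be invertible,
  -- and then the vanishing of `const x` would give `1# ≈ 0#` among the functions.
  const-injective : ∀ {x} → const x ≈ 0# → x K.≈ K.0#
  const-injective {x} cx≈0 = proj₁ (K.tight x K.0#) λ x#0 →
    let y , xy≈1 = FieldProperties.#0⇒invertibleʳ K x#0 in nontrivial (begin
      1#                  ≈⟨ 1#-homo ⟨
      const K.1#          ≈⟨ ⟦⟧-cong xy≈1 ⟨
      const (x K.* y)     ≈⟨ *-homo x y ⟩
      const x * const y   ≈⟨ *-congʳ cx≈0 ⟩
      0# * const y        ≈⟨ zeroˡ _ ⟩
      0#                  ∎)

  ∂-1 : ∂ 1# ≈ 0#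
  ∂-1 = trans (∂-cong (sym 1#-homo)) (∂-const K.1#)

  ∂^-const-* : ∀ n a f → ∂^ n (const a * f) ≈ const a * ∂^ n f
  ∂^-const-* zero    a f = refl
  ∂^-const-* (suc n) a f = begin
    ∂ (∂^ n (const a * f))                        ≈⟨ ∂-cong (∂^-const-* n a f) ⟩
    ∂ (const a * ∂^ n f)                          ≈⟨ ∂-* _ _ ⟩
    ∂ (const a) * ∂^ n f + const a * ∂ (∂^ n f)   ≈⟨ +-congʳ (trans (*-congʳ (∂-const a)) (zeroˡ _)) ⟩
    0# + const a * ∂ (∂^ n f)                     ≈⟨ +-identityˡ _ ⟩
    const a * ∂ (∂^ n f)                          ∎

  -- The factor `z` avoids the exponent n - 1, so that n = 0 needs no separate formula. The
  -- induction is mutual with `∂-z^suc`.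
  z∂-z^ : ∀ n → z * ∂ (z ^ n) ≈ n · (z ^ n)
  ∂-z^suc : ∀ n → ∂ (z ^ suc n) ≈ suc n · (z ^ n)

  z∂-z^ zero    = trans (*-congˡ ∂-1) (zeroʳ z)
  z∂-z^ (suc n) = trans (*-congˡ (∂-z^suc n)) (×-comm-* (suc n) z (z ^ n))

  ∂-z^suc n = begin
    ∂ (z * z ^ n)                 ≈⟨ ∂-* z (z ^ n) ⟩
    ∂ z * z ^ n + z * ∂ (z ^ n)   ≈⟨ +-cong (trans (*-congʳ ∂-z) (*-identityˡ _)) (z∂-z^ n) ⟩
    z ^ n + n · (z ^ n)           ∎

  ∂^suc-z^suc : ∀ j n → ∂^ (suc j) (z ^ suc n) ≈ suc n · ∂^ j (z ^ n)
  ∂^suc-z^suc j n = begin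
    ∂^ (suc j) (z ^ suc n)   ≡⟨ iter-suc ∂ j _ ⟩
    ∂^ j (∂ (z ^ suc n))     ≈⟨ ∂^-cong j (∂-z^suc n) ⟩
    ∂^ j (suc n · (z ^ n))   ≈⟨ ∂^-· j (suc n) _ ⟩
    suc n · ∂^ j (z ^ n)     ∎

  ∂^n-z^n : ∀ n → ∂^ n (z ^ n) ≈ (n !) · 1#
  ∂^n-z^n zero    = sym (+-identityʳ 1#)
  ∂^n-z^n (suc n) = begin
    ∂^ (suc n) (z ^ suc n)     ≈⟨ ∂^suc-z^suc n n ⟩
    suc n · ∂^ n (z ^ n)       ≈⟨ ×-congʳ (suc n) (∂^n-z^n n) ⟩
    suc n · ((n !) · 1#)       ≈⟨ ×-assocˡ 1# (suc n) (n !) ⟩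
    (suc n !) · 1#             ∎

  ∂^-z^-> : ∀ {n j} → n < j → ∂^ j (z ^ n) ≈ 0#
  ∂^-z^-> {zero} {suc j} _ = begin
    ∂^ (suc j) 1#   ≡⟨ iter-suc ∂ j 1# ⟩
    ∂^ j (∂ 1#)     ≈⟨ ∂^-cong j ∂-1 ⟩
    ∂^ j 0#         ≈⟨ ∂^-0 j ⟩
    0#              ∎
  ∂^-z^-> {suc n} {suc j} (s≤s n<j) = begin
    ∂^ (suc j) (z ^ suc n)   ≈⟨ ∂^suc-z^suc j n ⟩
    suc n · ∂^ j (z ^ n)     ≈⟨ ×-congʳ (suc n) (∂^-z^-> n<j) ⟩
    suc n · 0#               ≈⟨ ·-0 (suc n) ⟩
    0#                       ∎
    where
    ·-0 : ∀ m → m · 0# ≈ 0#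
    ·-0 m = trans (×-congʳ m (sym (zeroʳ 0#))) (trans (sym (×-comm-* m 0# 0#)) (zeroˡ _))

  -- Linear independence of the operators zʲ(d/dz)ʲ

  E : ℕ → Carrier → Carrier
  E j f = z ^ j * ∂^ j f

  -- `E n (z ^ n)` is n! times `z ^ n`. The outer `∂^ n` turns this into a constant without
  -- cancelling `z ^ n`, at the price of a second factor n!.
  E-diagonal : ∀ n → ∂^ n (E n (z ^ n)) ≈ (n ! ℕ.* n !) · 1#
  E-diagonal n = begin
    ∂^ n (z ^ n * ∂^ n (z ^ n))     ≈⟨ ∂^-cong n (*-congˡ (∂^n-z^n n)) ⟩
    ∂^ n (z ^ n * ((n !) · 1#))     ≈⟨ ∂^-cong n (trans (×-comm-* (n !) _ 1#) (×-congʳ (n !) (*-identityʳ _))) ⟩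
    ∂^ n ((n !) · (z ^ n))          ≈⟨ ∂^-· n (n !) _ ⟩
    (n !) · ∂^ n (z ^ n)            ≈⟨ ×-congʳ (n !) (∂^n-z^n n) ⟩
    (n !) · ((n !) · 1#)            ≈⟨ ×-assocˡ 1# (n !) (n !) ⟩
    (n ! ℕ.* n !) · 1#              ∎

  -- At f = zʲ the terms above j vanish, and those below j do so by induction.
  E-independent : ∀ n (d : ℕ → K.Carrier) →
                  (∀ f → sum {n} (λ i → const (d (toℕ i)) * E (toℕ i) f) ≈ 0#) →
                  ∀ j → j < n → d j K.≈ K.0#
  E-independent n d Σ≈0 = <-rec _ step
    where
    step : ∀ j → (∀ {i} → i < j → i < n → d i K.≈ K.0#) → j < n → d j K.≈ K.0#
    step j rec j<n = FieldProperties.*-cancelʳ-0 K (FieldProperties.fromℕ#0 K N {{N≢0}}) (const-injective (begin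
      const (d j K.* fromℕ K N)                   ≈⟨ *-homo _ _ ⟩
      const (d j) * const (fromℕ K N)             ≈⟨ *-congˡ (const-fromℕ N) ⟩
      const (d j) * (N · 1#)                      ≈⟨ *-congˡ (E-diagonal j) ⟨
      const (d j) * ∂^ j (E j (z ^ j))            ≈⟨ ∂^-const-* j (d j) _ ⟨
      ∂^ j (const (d j) * E j (z ^ j))            ≈⟨ ∂^-cong j term-j ⟩
      ∂^ j 0#                                     ≈⟨ ∂^-0 j ⟩
      0#                                          ∎))
      where
      N = j ! ℕ.* j !
      N≢0 : NonZero N
      N≢0 = ℕ.m*n≢0 (j !) (j !) {{ℕ._!≢0 j}} {{ℕ._!≢0 j}}
      term : ℕ → Carrier
      term i = const (d i) * E i (z ^ j)
      others : ∀ i → i ≢ fromℕ< j<n → term (toℕ i) ≈ 0#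
      others i i≢j with ℕ.<-cmp (toℕ i) j
      ... | tri< i<j _ _ = trans (*-congʳ (trans (⟦⟧-cong (rec i<j (toℕ<n i))) 0#-homo)) (zeroˡ _)
      ... | tri≈ _ i≡j _ = contradiction (toℕ-injective (≡.trans i≡j (≡.sym (toℕ-fromℕ< j<n)))) i≢j
      ... | tri> _ _ j<i = trans (*-congˡ (trans (*-congˡ (∂^-z^-> j<i)) (zeroʳ _))) (zeroʳ _)
      term-j : term j ≈ 0#
      term-j = begin
        term j                      ≡⟨ ≡.cong term (toℕ-fromℕ< j<n) ⟨
        term (toℕ (fromℕ< j<n))     ≈⟨ sum-single {n} (term ∘ toℕ) (fromℕ< j<n) others ⟨
        sum {n} (term ∘ toℕ)        ≈⟨ Σ≈0 (z ^ j) ⟩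
        0#                          ∎

  E-coefficients-unique : ∀ n (a b : ℕ → K.Carrier) →
    (∀ f → sum {n} (λ i → const (a (toℕ i)) * E (toℕ i) f)
           ≈ sum {n} (λ i → const (b (toℕ i)) * E (toℕ i) f)) →
    ∀ j → j < n → a j K.≈ b j
  E-coefficients-unique n a b Σa≈Σb j j<n =
    K.trans (K.sym (b+d≈a j)) (K.trans (K.+-congˡ (E-independent n d Σd≈0 j j<n)) (K.+-identityʳ (b j)))
    where
    d : ℕ → K.Carrier
    d i = K.- b i K.+ a i
    b+d≈a : ∀ i → b i K.+ d i K.≈ a i
    b+d≈a i = K.trans (K.sym (K.+-assoc (b i) (K.- b i) (a i)))
              (K.trans (K.+-congʳ (K.-‿inverseʳ (b i))) (K.+-identityˡ (a i)))
    Σ : (ℕ → K.Carrier) → Carrier → Carrier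
    Σ c f = sum {n} (λ i → const (c (toℕ i)) * E (toℕ i) f)
    -- As `b i + d i` equals `a i`, adding `Σ d f` to `Σ b f` leaves it unchanged; this spares
    -- evaluating `const` at a negative.
    Σd≈0 : ∀ f → Σ d f ≈ 0#
    Σd≈0 f = identityʳ-unique (Σ b f) (Σ d f) (begin
      Σ b f + Σ d f
        ≈⟨ ∑-distrib-+ {n} (λ i → const (b (toℕ i)) * E (toℕ i) f) (λ i → const (d (toℕ i)) * E (toℕ i) f) ⟨
      sum {n} (λ i → const (b (toℕ i)) * E (toℕ i) f + const (d (toℕ i)) * E (toℕ i) f)
        ≈⟨ sum-cong-≋ {n} (λ i → trans (sym (distribʳ _ _ _))
                                        (*-congʳ (trans (sym (+-homo _ _)) (⟦⟧-cong (b+d≈a (toℕ i)))))) ⟩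
      Σ a f
        ≈⟨ Σa≈Σb f ⟩
      Σ b f ∎)

  -- Powers of z d/dz

  z∂ : Carrier → Carrier
  z∂ = A[_] K M z

  open Additive {T = z∂} (λ f≈g → *-congˡ (∂-cong f≈g))
                         (λ f g → trans (*-congˡ (∂-+ f g)) (distribˡ _ _ _))
    using () renaming (T-· to z∂-·; T-sum to z∂-sum)

  -- The two terms of the Leibniz rule are the source of the two terms of the Stirling recurrence.
  z∂-E : ∀ j f → z∂ (E j f) ≈ j · E j f + E (suc j) f
  z∂-E j f = begin
    z * ∂ (z ^ j * ∂^ j f)
      ≈⟨ *-congˡ (∂-* _ _) ⟩
    z * (∂ (z ^ j) * ∂^ j f + z ^ j * ∂^ (suc j) f)
      ≈⟨ distribˡ _ _ _ ⟩
    z * (∂ (z ^ j) * ∂^ j f) + z * (z ^ j * ∂^ (suc j) f)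
      ≈⟨ +-cong (*-assoc _ _ _) (*-assoc _ _ _) ⟨
    z * ∂ (z ^ j) * ∂^ j f + E (suc j) f
      ≈⟨ +-congʳ (trans (*-congʳ (z∂-z^ j)) (×-assoc-* j _ _)) ⟩
    j · E j f + E (suc j) f ∎

  z∂^-expansion : ∀ k f → iter K M z∂ k f ≈ sum {suc k} (λ i → stirling k (toℕ i) · E (toℕ i) f)
  z∂^-expansion zero f = begin
    f                       ≈⟨ *-identityˡ f ⟨
    1# * f                  ≈⟨ +-identityʳ _ ⟨
    1# * f + 0#             ≈⟨ +-identityʳ _ ⟨
    1# * f + 0# + 0#        ∎
  z∂^-expansion (suc k) f = begin
    z∂ (iter K M z∂ k f)
      ≈⟨ *-congˡ (∂-cong (z∂^-expansion k f)) ⟩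
    z∂ (sum {suc k} (λ i → S (toℕ i) · E (toℕ i) f))
      ≈⟨ z∂-sum {suc k} (λ i → S (toℕ i) · E (toℕ i) f) ⟩
    sum {suc k} (λ i → z∂ (S (toℕ i) · E (toℕ i) f))
      ≈⟨ sum-cong-≋ {suc k} (λ i → term (toℕ i)) ⟩
    sum {suc k} (λ i → p (toℕ i) + q (toℕ i))
      ≈⟨ ∑-distrib-+ {suc k} (p ∘ toℕ) (q ∘ toℕ) ⟩
    sum {suc k} (p ∘ toℕ) + sum {suc k} (q ∘ toℕ)
      ≈⟨ +-congʳ shift ⟩
    sum {suc k} (p ∘ suc ∘ toℕ) + sum {suc k} (q ∘ toℕ)
      ≈⟨ +-comm _ _ ⟩
    sum {suc k} (q ∘ toℕ) + sum {suc k} (p ∘ suc ∘ toℕ)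
      ≈⟨ ∑-distrib-+ {suc k} (q ∘ toℕ) (p ∘ suc ∘ toℕ) ⟨
    sum {suc k} (λ i → q (toℕ i) + p (suc (toℕ i)))
      ≈⟨ sum-cong-≋ {suc k} (λ i → recurrence (toℕ i)) ⟩
    sum {suc k} (λ i → stirling (suc k) (suc (toℕ i)) · E (suc (toℕ i)) f)
      -- The added summand at index 0 is 0 by computation: the empty family does not cover `suc k`
      -- points.
      ≈⟨ +-identityˡ _ ⟨
    sum {suc (suc k)} (λ i → stirling (suc k) (toℕ i) · E (toℕ i) f) ∎
    where
    S : ℕ → ℕ
    S = stirling k
    p q : ℕ → Carrier
    p j = (j ℕ.* S j) · E j f
    q j = S j · E (suc j) f
    term : ∀ j → z∂ (S j · E j f) ≈ p j + q j
    term j = begin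
      z∂ (S j · E j f)                        ≈⟨ z∂-· (S j) _ ⟩
      S j · z∂ (E j f)                        ≈⟨ ×-congʳ (S j) (z∂-E j f) ⟩
      S j · (j · E j f + E (suc j) f)         ≈⟨ ·-distrib-+ _ _ (S j) ⟩
      S j · (j · E j f) + q j                 ≈⟨ +-congʳ (×-assocˡ _ (S j) j) ⟩
      (S j ℕ.* j) · E j f + q j               ≡⟨ ≡.cong (λ n → n · E j f + q j) (ℕ.*-comm (S j) j) ⟩
      p j + q j                               ∎
    -- Moving the range of `p` from 0, ..., k to 1, ..., k + 1 changes nothing: `p 0` has the factor
    -- 0, and `p (suc k)` has the factor `stirling k (suc k)`, which is 0.
    shift : sum {suc k} (p ∘ toℕ) ≈ sum {suc k} (p ∘ suc ∘ toℕ)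
    shift = begin
      sum {suc k} (p ∘ toℕ)               ≈⟨ +-identityˡ _ ⟩
      sum {k} (p ∘ suc ∘ toℕ)             ≈⟨ +-identityʳ _ ⟨
      sum {k} (p ∘ suc ∘ toℕ) + 0#
        ≡⟨ ≡.cong (λ n → sum {k} (p ∘ suc ∘ toℕ) + n · E (suc k) f)
                  (≡.trans (≡.cong (suc k ℕ.*_) (stirling-> k ℕ.≤-refl)) (ℕ.*-zeroʳ k)) ⟨
      sum {k} (p ∘ suc ∘ toℕ) + p (suc k) ≈⟨ sum-last k (p ∘ suc) ⟨
      sum {suc k} (p ∘ suc ∘ toℕ)         ∎
    recurrence : ∀ j → q j + p (suc j) ≈ stirling (suc k) (suc j) · E (suc j) f
    recurrence j = begin
      q j + p (suc j)                                   ≈⟨ ×-homo-+ _ (S j) _ ⟨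
      (S j ℕ.+ suc j ℕ.* S (suc j)) · E (suc j) f       ≡⟨ ≡.cong (_· E (suc j) f) (stirling-suc-suc k j) ⟨
      stirling (suc k) (suc j) · E (suc j) f            ∎

  -- The monomials at u = z

  1^ : ∀ {x} n → x ≈ 1# → x ^ n ≈ 1#
  1^ zero    x≈1 = refl
  1^ (suc n) x≈1 = trans (*-cong x≈1 (1^ n x≈1)) (*-identityʳ 1#)

  ∂^-z : ∀ n → ∂^ (suc (suc n)) z ≈ 0#
  ∂^-z zero    = trans (∂-cong ∂-z) ∂-1
  ∂^-z (suc n) = trans (∂-cong (∂^-z n)) ∂-0

  monomial-z-first : ∀ a n → monomial K M z (a ∷ replicate n 0) ≈ 1#
  monomial-z-first a n =
    trans (*-cong (1^ a ∂-z) (trans (Product.sum-cong-≋ {n} (λ i →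
                                       reflexive (≡.cong (∂^ (suc (suc (toℕ i))) z ^_) (lookup-replicate i 0))))
                                    (Product.sum-replicate-zero n)))
          (*-identityʳ 1#)

  -- A positive entry of `α` is the exponent of a derivative of `z` of order at least two, so one
  -- factor of the product is 0.
  monomial-z-rest : ∀ a {n} (α : Vec ℕ n) → α ≢ replicate n 0 → monomial K M z (a ∷ α) ≈ 0#
  monomial-z-rest a {n} α α≢0 with zero-or-positive α
  ... | inj₁ α≡0         = contradiction α≡0 α≢0
  ... | inj₂ (i , b , p) = begin
    product t
      ≈⟨ Product.sum-remove {i = suc i} t ⟩
    t (suc i) * product (λ j → t (punchIn (suc i) j))
      ≈⟨ *-congʳ (trans (reflexive (≡.cong (∂^ (suc (suc (toℕ i))) z ^_) p))
                        (trans (*-congʳ (∂^-z (toℕ i))) (zeroˡ _))) ⟩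
    0# * product (λ j → t (punchIn (suc i) j))
      ≈⟨ zeroˡ _ ⟩
    0# ∎
    where
    t : Vector Carrier (suc n)
    t j = ∂^ (suc (toℕ j)) z ^ lookup (a ∷ α) j

  module _ (C : Coefficients K) (k : ℕ) where

    term : ∀ s m → Vec ℕ s → Carrier
    term s m α = const (C s m k α) * monomial K M z α

    term-0 : ∀ {s m} a (α : Vec ℕ s) → α ≢ replicate s 0 → term (suc s) m (a ∷ α) ≈ 0#
    term-0 a α α≢0 = trans (*-congˡ (monomial-z-rest a α α≢0)) (zeroʳ _)

    -- A vector whose monomial survives has the form (a, 0, ..., 0). Its sum m and its weight
    -- `suc s` are then both a.
    sum-exponents-≢ : ∀ {s m} → m ≢ suc s → sumOver K M (exponents (suc s) m) (term (suc s) m) ≈ 0#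
    sum-exponents-≢ {s} {m} m≢s = sumOver-0 (exponents (suc s) m) vanish
      where
      vanish : ∀ {α} → α ∈ exponents (suc s) m → term (suc s) m α ≈ 0#
      vanish {a ∷ α} α∈ = term-0 a α λ { ≡.refl →
        let sum≡m , weight≡s = Equivalence.to ∈-exponents α∈ in
        m≢s (≡.trans (≡.sym sum≡m) (≡.trans (sum-first a s) (≡.trans (≡.sym (weight-first a s)) weight≡s))) }

    sum-exponents-≡ : ∀ s → sumOver K M (exponents (suc s) (suc s)) (term (suc s) (suc s))
                            ≈ const (C (suc s) (suc s) k (suc s ∷ replicate s 0))
    sum-exponents-≡ s = begin
      sumOver K M (exponents (suc s) (suc s)) (term (suc s) (suc s))
        ≈⟨ sumOver-single (unique-exponents (suc s) (suc s))
             (Equivalence.from ∈-exponents (sum-first (suc s) s , weight-first (suc s) s)) vanish ⟩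
      term (suc s) (suc s) (suc s ∷ replicate s 0)
        ≈⟨ *-congˡ (monomial-z-first (suc s) s) ⟩
      const (C (suc s) (suc s) k (suc s ∷ replicate s 0)) * 1#
        ≈⟨ *-identityʳ _ ⟩
      const (C (suc s) (suc s) k (suc s ∷ replicate s 0)) ∎
      where
      vanish : ∀ {α} → α ∈ exponents (suc s) (suc s) → α ≢ suc s ∷ replicate s 0 → term (suc s) (suc s) α ≈ 0#
      vanish {a ∷ α} α∈ α≢ = term-0 a α λ { ≡.refl → α≢ (≡.cong (_∷ replicate s 0)
        (≡.trans (≡.sym (sum-first a s)) (proj₁ (Equivalence.to ∈-exponents α∈)))) }

    sum-m : ∀ s → sumFrom1To K M (suc s) (λ m → z ^ (k ∸ m) * sumOver K M (exponents (suc s) m) (term (suc s) m))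
                  ≈ z ^ (k ∸ suc s) * const (C (suc s) (suc s) k (suc s ∷ replicate s 0))
    sum-m s = begin
      sum {suc s} (g ∘ suc ∘ toℕ)           ≈⟨ sum-last s (g ∘ suc) ⟩
      sum {s} (g ∘ suc ∘ toℕ) + g (suc s)
        ≈⟨ +-cong (sum-0 {s} (λ i → trans (*-congˡ (sum-exponents-≢ (ℕ.<⇒≢ (s≤s (toℕ<n i))))) (zeroʳ _)))
                  (*-congˡ (sum-exponents-≡ s)) ⟩
      0# + z ^ (k ∸ suc s) * const (C (suc s) (suc s) k (suc s ∷ replicate s 0))
        ≈⟨ +-identityˡ _ ⟩
      z ^ (k ∸ suc s) * const (C (suc s) (suc s) k (suc s ∷ replicate s 0)) ∎
      where
      g : ℕ → Carrier
      g m = z ^ (k ∸ m) * sumOver K M (exponents (suc s) m) (term (suc s) m)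

  -- Comparison of coefficients

  module _ {C : Coefficients K} (expansionC : IsExpansionCoefficients K M C) (k : ℕ) where
    open IsExpansionCoefficients expansionC

    -- The index is the drop in order below `suc k`. The value `1#` at 0 stands for the leading
    -- term, which the expansion keeps outside its double sum.
    coefficient : ℕ → K.Carrier
    coefficient zero    = K.1#
    coefficient (suc s) = C (suc s) (suc s) (suc k) (suc s ∷ replicate s 0)

    expansion-z : ∀ f → expansion K M C (suc k) z f
                        ≈ sum {suc (suc k)} (λ i → const (coefficient (toℕ i)) * E (suc k ∸ toℕ i) f)
    expansion-z f = begin
      E (suc k) f + sum {k} _
        ≈⟨ +-cong (trans (sym (*-identityˡ _)) (*-congʳ (sym 1#-homo)))
                  (sum-cong-≋ {k} (λ i → trans (*-congʳ (sum-m C (suc k) (toℕ i)))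
                                        (trans (*-congʳ (*-comm _ _)) (*-assoc _ _ _)))) ⟩
      h 0 + sum {k} (h ∘ suc ∘ toℕ)
        -- The double sum ends at s = k. The convention supplies a vanishing summand at s = k + 1,
        -- so that every order from 0 to k + 1 occurs.
        ≈⟨ +-congˡ (trans (sym (+-identityʳ _)) (+-congˡ (sym h-last))) ⟩
      h 0 + (sum {k} (h ∘ suc ∘ toℕ) + h (suc k))
        ≈⟨ +-congˡ (sum-last k (h ∘ suc)) ⟨
      h 0 + sum {suc k} (h ∘ suc ∘ toℕ) ∎
      where
      h : ℕ → Carrier
      h s = const (coefficient s) * E (suc k ∸ s) f
      h-last : h (suc k) ≈ 0#
      h-last = trans (*-congʳ (trans (⟦⟧-cong (convention (suc k) (suc k) _ (s≤s z≤n) (s≤s z≤n) ℕ.≤-refl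
                                                 (sum-first (suc k) k , weight-first (suc k) k))) 0#-homo))
                     (zeroˡ _)

    coefficient-stirling : ∀ j → j < suc (suc k) → coefficient (suc k ∸ j) K.≈ fromℕ K (stirling (suc k) j)
    coefficient-stirling = E-coefficients-unique (suc (suc k)) _ _ λ f → begin
      sum {suc (suc k)} (λ i → const (coefficient (suc k ∸ toℕ i)) * E (toℕ i) f)
        -- Uniqueness is indexed by the order of derivation, the expansion by the drop in order;
        -- reversal passes between the two.
        ≈⟨ sum-reverse (suc k) (λ j → const (coefficient (suc k ∸ j)) * E j f) ⟨
      sum {suc (suc k)} (λ i → const (coefficient (suc k ∸ (suc k ∸ toℕ i))) * E (suc k ∸ toℕ i) f)
        ≈⟨ sum-cong-≋ {suc (suc k)} (λ i → reflexive (≡.cong (λ s → const (coefficient s) * E (suc k ∸ toℕ i) f)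
             (ℕ.m∸[m∸n]≡n (ℕ.≤-pred (toℕ<n i))))) ⟩
      sum {suc (suc k)} (λ i → const (coefficient (toℕ i)) * E (suc k ∸ toℕ i) f)
        ≈⟨ expansion-z f ⟨
      expansion K M C (suc k) z f
        ≈⟨ expands (suc k) (s≤s z≤n) z f ⟨
      iter K M z∂ (suc k) f
        ≈⟨ z∂^-expansion (suc k) f ⟩
      sum {suc (suc k)} (λ i → stirling (suc k) (toℕ i) · E (toℕ i) f)
        ≈⟨ sum-cong-≋ {suc (suc k)} (λ i → const-fromℕ-* (stirling (suc k) (toℕ i)) (E (toℕ i) f)) ⟨
      sum {suc (suc k)} (λ i → const (fromℕ K (stirling (suc k) (toℕ i))) * E (toℕ i) f) ∎

corollary3p2 : {c ℓ₁ ℓ₂ r ℓ : Level}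
    (K : CharZeroField c ℓ₁ ℓ₂) (M : FunctionRing K r ℓ)
    (C : Coefficients K) → IsExpansionCoefficients K M C →
    let open CharZeroField K using (_≈_) in
    (k s : ℕ) → s ≤ k →
    C (suc s) (suc s) (suc k) (suc s ∷ replicate s 0) ≈ fromℕ K (stirling (suc k) (k ∸ s))
corollary3p2 K M C expansionC k s s≤k =
  -- Order `k ∸ s` belongs to the index `suc k ∸ (k ∸ s)`. This equals `suc s`, because `k ∸ s` is
  -- `suc k ∸ suc s` by computation.
  ≡.subst (λ t → coefficient expansionC k t ≈ fromℕ K (stirling (suc k) (k ∸ s))) (ℕ.m∸[m∸n]≡n (s≤s s≤k))
    (coefficient-stirling expansionC k (k ∸ s) (s≤s (ℕ.m≤n⇒m≤1+n (ℕ.m∸n≤m k s))))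
  where
  open CharZeroField K using (_≈_)
  open FunctionRingProperties M
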